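{- For every integer $n > 2$, the tensor product graph $P_n \wedge P_2$ is odd graceful.
   Context: All graphs are finite and simple. $P_n$ denotes the path graph on $n$ vertices. The tensor product $G_1 \wedge G_2$ of two graphs $G_1, G_2$ is the graph with vertex set $V(G_1) \times V(G_2)$ in which $(u_1,v_1)$ and $(u_2,v_2)$ are adjacent if and only if $u_1u_2 \in E(G_1)$ and $v_1v_2 \in E(G_2)$. An odd graceful labeling of a graph $G$ with $q = |E(G)|$ edges is a one-to-one function $f : V(G) \to \{0,1,2,\ldots,2q-1\}$ such that, when each edge $uv$ is given the label $f^*(uv) = |f(u)-f(v)|$, the resulting set of edge labels is exactly $\{1,3,5,\ldots,2q-1\}$ (so the $q$ edge labels are distinct). A graph is odd graceful if it has an odd graceful labeling. -}

module Defs where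

open import Data.Fin.Base using (Fin; toℕ)
open import Data.Fin.Properties using (*↔×)
open import Data.Nat.Base using (ℕ; suc; _+_; _*_; _<_; ∣_-_∣)
open import Data.Nat.Properties using (_≟_; 1+n≢n)
open import Data.Product.Base using (Σ; ∃-syntax; _×_; _,_)
open import Data.Product.Function.NonDependent.Propositional using (_×-↔_)
open import Data.Sum.Base using (_⊎_; inj₁; inj₂; swap; [_,_])
open import Function.Bundles using (Inverse; _↔_)
open import Function.Construct.Composition using (_↔-∘_)
open import Function.Construct.Identity using (↔-id)
open import Function.Definitions using (Injective)
open import Level using (0ℓ)
open import Relation.Binary.Bundles using (Setoid)
open import Relation.Binary.Core using (Rel)
open import Relation.Binary.Definitions using (Symmetric; Decidable)
open import Relation.Binary.PropositionalEquality using (_≡_; refl; sym; trans; setoid)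
open import Relation.Nullary.Decidable using (_×-dec_; _⊎-dec_)
open import Relation.Nullary.Negation using (¬_)
open import Relation.Unary using (Pred; _≐_)

-- Adjacency is decidable, as always for a finite graph classically.
record Graph : Set₁ where
  field
    Vertex     : Set
    Adj        : Rel Vertex 0ℓ
    adj-sym    : Symmetric Adj
    adj-irrefl : ∀ {v} → ¬ Adj v v
    adj?       : Decidable Adj
    order      : ℕ
    finite     : Fin order ↔ Vertex

  -- The edge set E(G): adjacent pairs, where (u , v) and (v , u) are the same
  -- edge and the proof of adjacency is disregarded.
  Edge : Set
  Edge = Σ (Vertex × Vertex) λ (u , v) → Adj u v

  _≈ₑ_ : Rel Edge 0ℓ
  ((u , v) , _) ≈ₑ ((u′ , v′) , _) = (u ≡ u′ × v ≡ v′) ⊎ (u ≡ v′ × v ≡ u′)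

  edgeSetoid : Setoid 0ℓ 0ℓ
  edgeSetoid = record
    { Carrier = Edge
    ; _≈_ = _≈ₑ_
    ; isEquivalence = record
      { refl  = inj₁ (refl , refl)
      ; sym   = λ { (inj₁ (p , q)) → inj₁ (sym p , sym q)
                  ; (inj₂ (p , q)) → inj₂ (sym q , sym p) }
      ; trans = λ { (inj₁ (p , q)) (inj₁ (r , s)) → inj₁ (trans p r , trans q s)
                  ; (inj₁ (p , q)) (inj₂ (r , s)) → inj₂ (trans p r , trans q s)
                  ; (inj₂ (p , q)) (inj₁ (r , s)) → inj₂ (trans p s , trans q r)
                  ; (inj₂ (p , q)) (inj₂ (r , s)) → inj₁ (trans p s , trans q r) }
      }
    }

open Graph

-- |E(G)| = q; this determines q.
HasSize : Graph → ℕ → Set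
HasSize G q = Inverse (setoid (Fin q)) (edgeSetoid G)

path : ℕ → Graph
path n = record
  { Vertex     = Fin n
  ; Adj        = λ i j → suc (toℕ i) ≡ toℕ j ⊎ suc (toℕ j) ≡ toℕ i
  ; adj-sym    = swap
  ; adj-irrefl = [ 1+n≢n , 1+n≢n ]
  ; adj?       = λ i j → (suc (toℕ i) ≟ toℕ j) ⊎-dec (suc (toℕ j) ≟ toℕ i)
  ; order      = n
  ; finite     = ↔-id (Fin n)
  }

infixr 6 _∧_

_∧_ : Graph → Graph → Graph
G ∧ H = record
  { Vertex     = Vertex G × Vertex H
  ; Adj        = λ (u₁ , v₁) (u₂ , v₂) → Adj G u₁ u₂ × Adj H v₁ v₂
  ; adj-sym    = λ (a , b) → adj-sym G a , adj-sym H b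
  ; adj-irrefl = λ (a , _) → adj-irrefl G a
  ; adj?       = λ (u₁ , v₁) (u₂ , v₂) → adj? G u₁ u₂ ×-dec adj? H v₁ v₂
  ; order      = order G * order H
  ; finite     = (finite G ×-↔ finite H) ↔-∘ *↔×
  }

edgeLabel : (G : Graph) → (Vertex G → ℕ) → Edge G → ℕ
edgeLabel G f ((u , v) , _) = ∣ f u - f v ∣

EdgeLabels : (G : Graph) → (Vertex G → ℕ) → Pred ℕ 0ℓ
EdgeLabels G f k = ∃[ e ] edgeLabel G f e ≡ k

-- {1, 3, 5, …, 2q − 1}
FirstOdds : ℕ → Pred ℕ 0ℓ
FirstOdds q k = ∃[ i ] i < q × k ≡ 2 * i + 1

record OddGracefulLabeling (G : Graph) : Set where
  field
    q         : ℕ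
    size      : HasSize G q
    f         : Vertex G → Fin (2 * q)
    injective : Injective _≡_ _≡_ f
    labels    : EdgeLabels G (λ v → toℕ (f v)) ≐ FirstOdds q

OddGraceful : Graph → Set
OddGraceful = OddGracefulLabeling

{-# OPTIONS --safe #-}

-- Pₙ ∧ P₂ is the disjoint union of two copies of Pₙ: the vertex (i , s) lies in
-- copy s when i is even and in the other copy when i is odd.  With m = n − 1,
-- label the copies in zigzag as
--   0, 4m − 1, 2, 4m − 3, …      and      1, 2m, 3, 2m − 2, …
-- The edge labels fall by 2 along each copy: from 4m − 1 to 2m + 1 on the first
-- and from 2m − 1 to 1 on the second.
module Submission where

open import Defs
open import Data.Empty using (⊥-elim)
open import Data.Fin.Base using (Fin; zero; suc; toℕ; fromℕ<; inject₁; opposite)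
open import Data.Fin.Patterns using (0F; 1F)
open import Data.Fin.Properties
  using (*↔×; toℕ-injective; toℕ<n; toℕ≤pred[n]; toℕ-fromℕ<; fromℕ<-injective; toℕ-inject₁
        ; inject₁-injective)
open import Data.Nat.Base
open import Data.Nat.Properties
open import Data.Nat.Tactic.RingSolver using (solve-∀)
open import Data.Parity.Base as ℙ using (Parity; 0ℙ; 1ℙ; _⁻¹)
open import Data.Parity.Properties using (+-homo-+; suc-homo-⁻¹; ⁻¹-involutive)
open import Data.Product.Base using (∃-syntax; _×_; _,_; proj₁; proj₂)
open import Data.Sum.Base using (inj₁; inj₂)
open import Function.Base using (_∘_)
open import Function.Bundles using (Bijection)
open import Function.Construct.Composition using (inverse)
open import Function.Properties.Bijection using (Bijection⇒Inverse)
open import Relation.Binary.Bundles using (Setoid)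
open import Relation.Binary.PropositionalEquality
open import Relation.Nullary.Decidable using (yes; no)

open Graph

-- Parity and the numbering of the two copies

parity-suc : ∀ i → parity (suc i) ≡ parity i ⁻¹
parity-suc i = trans (sym (⁻¹-involutive _)) (cong _⁻¹ (suc-homo-⁻¹ i))

parity-1⇒> : ∀ i → parity i ≡ 1ℙ → 0 < i
parity-1⇒> (suc i) _ = z<s

parity-even-+ : ∀ i j → parity i ≡ 0ℙ → parity (i + j) ≡ parity j
parity-even-+ i j even = trans (+-homo-+ i j) (cong (ℙ._+ parity j) even)

parity-toℕ-injective : ∀ {c d : Fin 2} → parity (toℕ c) ≡ parity (toℕ d) → c ≡ d
parity-toℕ-injective {0F} {0F} _ = refl
parity-toℕ-injective {1F} {1F} _ = refl
parity-toℕ-injective {0F} {1F} ()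
parity-toℕ-injective {1F} {0F} ()

∸≡ : ∀ {a b c} → a ≡ c + b → a ∸ b ≡ c
∸≡ {b = b} {c} refl = m+n∸n≡m c b

-- Converts the second coordinate of a vertex to the number of its copy, given the parity of the
-- first coordinate. Being an involution, it also converts back.
twist : Parity → Fin 2 → Fin 2
twist 0ℙ s = s
twist 1ℙ s = opposite s

twist-involutive : ∀ p s → twist p (twist p s) ≡ s
twist-involutive 0ℙ s  = refl
twist-involutive 1ℙ 0F = refl
twist-involutive 1ℙ 1F = refl

twist-injective : ∀ p {s t} → twist p s ≡ twist p t → s ≡ t
twist-injective p {s} {t} eq = begin
  s                    ≡⟨ twist-involutive p s ⟨
  twist p (twist p s)  ≡⟨ cong (twist p) eq ⟩
  twist p (twist p t)  ≡⟨ twist-involutive p t ⟩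
  t                    ∎
  where open ≡-Reasoning

twist-⁻¹ : ∀ p s → twist (p ⁻¹) s ≡ opposite (twist p s)
twist-⁻¹ 0ℙ s  = refl
twist-⁻¹ 1ℙ 0F = refl
twist-⁻¹ 1ℙ 1F = refl

-- The first edge of copy c has label 2 * rank m c − 1.
rank : ℕ → Fin 2 → ℕ
rank m 0F = 2 * m
rank m 1F = m

-- Equals 4m on copy 0 and 2m + 1 on copy 1. The offset `toℕ c` cancels that of the even positions,
-- so edge labels depend on `rank` alone.
ceiling : ℕ → Fin 2 → ℕ
ceiling m c = 2 * rank m c + toℕ c

zigzag : ℕ → Parity → Fin 2 → ℕ → ℕ
zigzag m 0ℙ c i = i + toℕ c
zigzag m 1ℙ c i = ceiling m c ∸ i

toℕ≤1 : (c : Fin 2) → toℕ c ≤ 1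
toℕ≤1 = toℕ≤pred[n]

-- Range and injectivity of the zigzag labels

module _ {m : ℕ} (0<m : 0 < m) where

  open ≤-Reasoning

  2m<4m : 2 * m < 2 * (2 * m)
  2m<4m = begin-strict
    2 * m              <⟨ m<m+n (2 * m) (≤-trans 0<m (m≤m+n m _)) ⟩
    2 * m + 2 * m      ≡⟨ cong (2 * m +_) (+-identityʳ (2 * m)) ⟨
    2 * (2 * m)        ∎

  2m<ceiling : ∀ c → 2 * m < ceiling m c
  2m<ceiling 0F = ≤-trans 2m<4m (m≤m+n _ 0)
  2m<ceiling 1F = m<m+n (2 * m) z<s

  ≤⇒≤ceiling : ∀ c {i} → i ≤ m → i ≤ ceiling m c
  ≤⇒≤ceiling c i≤m = ≤-trans i≤m (≤-trans (m≤m+n m _) (<⇒≤ (2m<ceiling c)))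

  ceiling₁∸odd≤2m : ∀ i → parity i ≡ 1ℙ → ceiling m 1F ∸ i ≤ 2 * m
  ceiling₁∸odd≤2m i odd = begin
    ceiling m 1F ∸ i  ≤⟨ ∸-monoʳ-≤ (ceiling m 1F) (parity-1⇒> i odd) ⟩
    ceiling m 1F ∸ 1  ≡⟨ m+n∸n≡m (2 * m) 1 ⟩
    2 * m             ∎

  zigzag-< : ∀ p c {i} → parity i ≡ p → i ≤ m → zigzag m p c i < 2 * (2 * m)
  zigzag-< 0ℙ c {i} _ i≤m = begin-strict
    i + toℕ c ≤⟨ +-mono-≤ i≤m (≤-trans (toℕ≤1 c) 0<m) ⟩
    m + m     ≡⟨ cong (m +_) (+-identityʳ m) ⟨
    2 * m     <⟨ 2m<4m ⟩
    2 * (2 * m) ∎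
  -- Position 0 is even, so at least 1 is subtracted; the value 4m itself would be out of range.
  zigzag-< 1ℙ 0F {suc i} _ i≤m = begin-strict
    ceiling m 0F ∸ suc i  <⟨ ∸-monoʳ-< {o = 0} z<s (≤⇒≤ceiling 0F i≤m) ⟩
    ceiling m 0F          ≡⟨ +-identityʳ _ ⟩
    2 * (2 * m) ∎
  zigzag-< 1ℙ 1F {i} odd _ = ≤-<-trans (ceiling₁∸odd≤2m i odd) 2m<4m

  ≢⇒+<m+m : ∀ {i j} → i ≤ m → j ≤ m → i ≢ j → i + j < m + m
  ≢⇒+<m+m {i} {j} i≤m j≤m i≢j with i ≟ m
  ... | no  i≢m  = +-mono-<-≤ (≤∧≢⇒< i≤m i≢m) j≤m
  ... | yes refl = +-monoʳ-< m (≤∧≢⇒< j≤m (i≢j ∘ sym))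

  -- A common label would give `ceiling m d` = i + j + `toℕ c`. Distinct positions up to m have sum
  -- below 2m, so the right side is at most 2m, while the ceiling exceeds 2m.
  zigzag-even≢odd : ∀ {c d i j} → i ≤ m → j ≤ m → i ≢ j → zigzag m 0ℙ c i ≢ zigzag m 1ℙ d j
  zigzag-even≢odd {c} {d} {i} {j} i≤m j≤m i≢j eq = <-irrefl refl (begin-strict
    ceiling m d         ≡⟨ m∸n+n≡m (≤⇒≤ceiling d j≤m) ⟨
    ceiling m d ∸ j + j ≡⟨ cong (_+ j) eq ⟨
    i + toℕ c + j       ≡⟨ rearrange i (toℕ c) j ⟩
    i + j + toℕ c       <⟨ +-mono-<-≤ (≢⇒+<m+m i≤m j≤m i≢j) (toℕ≤1 c) ⟩
    m + m + 1           ≡⟨ double m ⟩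
    suc (2 * m)         ≤⟨ 2m<ceiling d ⟩
    ceiling m d         ∎)
    where
    rearrange : ∀ a b c → a + b + c ≡ a + c + b
    rearrange = solve-∀
    double : ∀ a → a + a + 1 ≡ suc (2 * a)
    double = solve-∀

  -- The label 4m - i is at least 3m, whereas odd positions of copy 1 have labels at most 2m.
  zigzag-odd-0≢1 : ∀ i j → i ≤ m → parity j ≡ 1ℙ → zigzag m 1ℙ 0F i ≢ zigzag m 1ℙ 1F j
  zigzag-odd-0≢1 i j i≤m odd eq = <-irrefl refl (begin-strict
    ceiling m 0F          ≡⟨ m∸n+n≡m (≤⇒≤ceiling 0F i≤m) ⟨
    ceiling m 0F ∸ i + i  ≡⟨ cong (_+ i) eq ⟩
    ceiling m 1F ∸ j + i  ≤⟨ +-mono-≤ (ceiling₁∸odd≤2m j odd) i≤m ⟩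
    2 * m + m             <⟨ m<m+n (2 * m + m) 0<m ⟩
    2 * m + m + m         ≡⟨ quadruple m ⟩
    ceiling m 0F          ∎)
    where
    quadruple : ∀ a → 2 * a + a + a ≡ 2 * (2 * a) + 0
    quadruple = solve-∀

  zigzag-injective : ∀ p q {c d i j} → parity i ≡ p → parity j ≡ q → i ≤ m → j ≤ m →
                     zigzag m p c i ≡ zigzag m q d j → c ≡ d × i ≡ j
  zigzag-injective 0ℙ 0ℙ {c} {d} {i} {j} pi pj _ _ eq
    -- At even positions the parity of the label is that of the copy number.
    with refl ← parity-toℕ-injective {c} {d}
           (trans (sym (parity-even-+ i _ pi)) (trans (cong parity eq) (parity-even-+ j _ pj)))
    = refl , +-cancelʳ-≡ (toℕ c) i j eq
  zigzag-injective 0ℙ 1ℙ {c} {d} pi pj i≤m j≤m eq =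
    ⊥-elim (zigzag-even≢odd {c} {d} i≤m j≤m (λ { refl → 0ℙ≢1ℙ (trans (sym pi) pj) }) eq)
    where
    0ℙ≢1ℙ : 0ℙ ≢ 1ℙ
    0ℙ≢1ℙ ()
  zigzag-injective 1ℙ 0ℙ {c} {d} pi pj i≤m j≤m eq
    with refl , refl ← zigzag-injective 0ℙ 1ℙ {d} {c} pj pi j≤m i≤m (sym eq) = refl , refl
  zigzag-injective 1ℙ 1ℙ {0F} {0F} _ _ i≤m j≤m eq =
    refl , ∸-cancelˡ-≡ (≤⇒≤ceiling 0F i≤m) (≤⇒≤ceiling 0F j≤m) eq
  zigzag-injective 1ℙ 1ℙ {1F} {1F} _ _ i≤m j≤m eq =
    refl , ∸-cancelˡ-≡ (≤⇒≤ceiling 1F i≤m) (≤⇒≤ceiling 1F j≤m) eq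
  zigzag-injective 1ℙ 1ℙ {0F} {1F} {i} {j} _ pj i≤m _ eq =
    ⊥-elim (zigzag-odd-0≢1 i j i≤m pj eq)
  zigzag-injective 1ℙ 1ℙ {1F} {0F} {i} {j} pi _ _ j≤m eq =
    ⊥-elim (zigzag-odd-0≢1 j i j≤m pi (sym eq))

-- Edge labels along a copy

zigzag-step : ∀ {m} p c {i j} → i + suc j ≡ rank m c →
              ∣ zigzag m p c j - zigzag m (p ⁻¹) c (suc j) ∣ ≡ 2 * i + 1
zigzag-step {m} 0ℙ c {i} {j} eq = begin
  ∣ j + toℕ c - ceiling m c ∸ suc j ∣        ≡⟨ cong ∣ j + toℕ c -_∣ (∸≡ high) ⟩
  ∣ j + toℕ c - (j + toℕ c) + (2 * i + 1) ∣  ≡⟨ ∣m-m+n∣≡n (j + toℕ c) (2 * i + 1) ⟩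
  2 * i + 1                                  ∎
  where
  open ≡-Reasoning
  rearrange : ∀ i j c → 2 * (i + suc j) + c ≡ j + c + (2 * i + 1) + suc j
  rearrange = solve-∀
  -- Splitting the ceiling as lower label, edge label and odd position makes the truncated
  -- subtraction exact.
  high : ceiling m c ≡ j + toℕ c + (2 * i + 1) + suc j
  high = trans (cong (λ r → 2 * r + toℕ c) (sym eq)) (rearrange i j (toℕ c))
zigzag-step {m} 1ℙ c {i} {j} eq = begin
  ∣ ceiling m c ∸ j - low ∣          ≡⟨ cong ∣_- low ∣ (∸≡ {b = j} high) ⟩
  ∣ low + (2 * i + 1) - low ∣        ≡⟨ ∣-∣-comm (low + (2 * i + 1)) low ⟩
  ∣ low - low + (2 * i + 1) ∣        ≡⟨ ∣m-m+n∣≡n low (2 * i + 1) ⟩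
  2 * i + 1                          ∎
  where
  open ≡-Reasoning
  low = suc j + toℕ c
  rearrange : ∀ i j c → 2 * (i + suc j) + c ≡ suc j + c + (2 * i + 1) + j
  rearrange = solve-∀
  high : ceiling m c ≡ low + (2 * i + 1) + j
  high = trans (cong (λ r → 2 * r + toℕ c) (sym eq)) (rearrange i j (toℕ c))

-- Enumeration of the edges

path₂-adj : ∀ s → Adj (path 2) s (opposite s)
path₂-adj 0F = inj₁ refl
path₂-adj 1F = inj₂ refl

path₂-adj⇒opposite : ∀ {s t} → Adj (path 2) s t → t ≡ opposite s
path₂-adj⇒opposite {0F} {1F} _ = refl
path₂-adj⇒opposite {1F} {0F} _ = refl
path₂-adj⇒opposite {0F} {0F} (inj₁ ())
path₂-adj⇒opposite {0F} {0F} (inj₂ ())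
path₂-adj⇒opposite {1F} {1F} (inj₁ ())
path₂-adj⇒opposite {1F} {1F} (inj₂ ())

module _ {m : ℕ} where

  G : Graph
  G = path (suc m) ∧ path 2

  private module E = Setoid (edgeSetoid G)

  stepFrom : (j : Fin m) (s : Fin 2) → Edge G
  stepFrom j s =
    ((inject₁ j , s) , (suc j , opposite s)) , inj₁ (cong suc (toℕ-inject₁ j)) , path₂-adj s

  -- Indexing by copy and position, rather than by the second coordinate, keeps the edges of one
  -- copy together.
  edge : Fin 2 × Fin m → Edge G
  edge (c , j) = stepFrom j (twist (parity (toℕ j)) c)

  edge-injective : ∀ {x y} → edge x E.≈ edge y → x ≡ y
  edge-injective {c , j} {d , k} (inj₁ (p , _))
    with refl ← inject₁-injective {i = j} {k} (cong proj₁ p)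
    = cong (_, j) (twist-injective (parity (toℕ j)) (cong proj₂ p))
  -- Opposite orientations would require both j = k + 1 and k = j + 1.
  edge-injective {c , j} {d , k} (inj₂ (p , q)) = ⊥-elim (<-asym
    (≤-reflexive (sym (trans (sym (toℕ-inject₁ j)) (cong (toℕ ∘ proj₁) p))))
    (≤-reflexive (trans (cong (toℕ ∘ proj₁) q) (toℕ-inject₁ k))))

  stepFrom≈edge : ∀ j s → stepFrom j s E.≈ edge (twist (parity (toℕ j)) s , j)
  stepFrom≈edge j s rewrite twist-involutive (parity (toℕ j)) s = inj₁ (refl , refl)

  forward≈edge : ∀ {i k s t} (a : suc (toℕ i) ≡ toℕ k) (b : Adj (path 2) s t) →
                 ∃[ x ] (((i , s) , (k , t)) , inj₁ a , b) E.≈ edge x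
  forward≈edge {i} {suc k} {s} a b
    with refl ← toℕ-injective {i = i} {inject₁ k} (trans (suc-injective a) (sym (toℕ-inject₁ k)))
       | refl ← path₂-adj⇒opposite b
    = (twist (parity (toℕ k)) s , k) , stepFrom≈edge k s

  edge-surjective : ∀ e → ∃[ x ] e E.≈ edge x
  edge-surjective (_ , inj₁ a , b) = forward≈edge a b
  -- An edge with descending first coordinate is reversed and treated as an ascending one.
  edge-surjective e@(((i , s) , (k , t)) , inj₂ a , b) =
    x , E.trans {e} {e⁻} {edge x} (inj₂ (refl , refl)) e⁻≈x
    where
    e⁻ : Edge G
    e⁻ = ((k , t) , (i , s)) , inj₁ a , adj-sym (path 2) {s} {t} b
    x = proj₁ (forward≈edge a (proj₂ (proj₂ e⁻)))
    e⁻≈x = proj₂ (forward≈edge a (proj₂ (proj₂ e⁻)))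

  edge-bijection : Bijection (setoid (Fin 2 × Fin m)) (edgeSetoid G)
  edge-bijection = record
    { to        = edge
    ; cong      = λ { refl → inj₁ (refl , refl) }
    ; bijective = (λ {x} {y} → edge-injective {x} {y})
                , λ e → proj₁ (edge-surjective e)
                      , λ { refl → E.sym {e} {edge _} (proj₂ (edge-surjective e)) }
    }

  size : HasSize G (2 * m)
  size = inverse *↔× (Bijection⇒Inverse edge-bijection)

-- The labeling and its set of edge labels

module _ {m : ℕ} (0<m : 0 < m) where

  private module E = Setoid (edgeSetoid (G {m}))

  label : Vertex (G {m}) → ℕ
  label (i , s) = zigzag m (parity (toℕ i)) (twist (parity (toℕ i)) s) (toℕ i)

  label-injective : ∀ {u v} → label u ≡ label v → u ≡ v
  label-injective {i , s} {j , t} eq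
    with p , q ← zigzag-injective 0<m (parity (toℕ i)) (parity (toℕ j)) refl refl
                                  (toℕ≤pred[n] i) (toℕ≤pred[n] j) eq
    with refl ← toℕ-injective q
    = cong (i ,_) (twist-injective (parity (toℕ i)) p)

  label-< : ∀ v → label v < 2 * (2 * m)
  label-< (i , s) = zigzag-< 0<m (parity (toℕ i)) (twist (parity (toℕ i)) s) refl (toℕ≤pred[n] i)

  f : Vertex (G {m}) → Fin (2 * (2 * m))
  f v = fromℕ< (label-< v)

  toℕ-f : ∀ v → toℕ (f v) ≡ label v
  toℕ-f v = toℕ-fromℕ< (label-< v)

  edgeLabel-cong : ∀ {e e′} → e E.≈ e′ → edgeLabel G (toℕ ∘ f) e ≡ edgeLabel G (toℕ ∘ f) e′
  edgeLabel-cong (inj₁ (refl , refl)) = refl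
  edgeLabel-cong {(u , v) , _} (inj₂ (refl , refl)) = ∣-∣-comm (toℕ (f u)) (toℕ (f v))

  edgeLabel-edge : ∀ c j {i} → i + suc (toℕ j) ≡ rank m c →
                   edgeLabel G (toℕ ∘ f) (edge (c , j)) ≡ 2 * i + 1
  edgeLabel-edge c j {i} eq = begin
    ∣ toℕ (f u) - toℕ (f v) ∣
      ≡⟨ cong₂ ∣_-_∣ (trans (toℕ-f u) label-u) (trans (toℕ-f v) label-v) ⟩
    ∣ zigzag m p c (toℕ j) - zigzag m (p ⁻¹) c (suc (toℕ j)) ∣
      ≡⟨ zigzag-step p c eq ⟩
    2 * i + 1 ∎
    where
    open ≡-Reasoning
    p = parity (toℕ j)
    u v : Vertex (G {m})
    u = inject₁ j , twist p c
    v = suc j , opposite (twist p c)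
    label-u : label u ≡ zigzag m p c (toℕ j)
    label-u rewrite toℕ-inject₁ j | twist-involutive p c = refl
    label-v : label v ≡ zigzag m (p ⁻¹) c (suc (toℕ j))
    -- Along an edge both the parity and the second coordinate flip, so the copy number is
    -- unchanged.
    label-v rewrite parity-suc (toℕ j) | sym (twist-⁻¹ p c) | twist-involutive (p ⁻¹) c = refl

  rank-bounds : ∀ c → m ≤ rank m c × rank m c ≤ 2 * m
  rank-bounds 0F = m≤m+n m _ , ≤-refl
  rank-bounds 1F = ≤-refl , m≤m+n m _

  edge⇒index : ∀ c (j : Fin m) → ∃[ i ] i < 2 * m × i + suc (toℕ j) ≡ rank m c
  edge⇒index c j = rank m c ∸ suc (toℕ j) , i<2m , eq
    where
    eq : rank m c ∸ suc (toℕ j) + suc (toℕ j) ≡ rank m c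
    eq = m∸n+n≡m (≤-trans (toℕ<n j) (proj₁ (rank-bounds c)))
    i<2m : rank m c ∸ suc (toℕ j) < 2 * m
    i<2m = ≤-trans (m<m+n _ z<s) (≤-trans (≤-reflexive eq) (proj₂ (rank-bounds c)))

  -- The m edges of copy c realise the m consecutive indices from `rank m c` - m to `rank m c` - 1,
  -- in decreasing order.
  copy-index : ∀ c {i} → i < rank m c → rank m c ≤ i + m → ∃[ j ] i + suc (toℕ {m} j) ≡ rank m c
  copy-index c {i} i<r r≤i+m = fromℕ< j<m , trans (cong (λ k → i + suc k) (toℕ-fromℕ< j<m)) eq
    where
    j = rank m c ∸ suc i
    eq : i + suc j ≡ rank m c
    eq = trans (+-suc i j) (m+[n∸m]≡n i<r)
    j<m : j < m
    j<m = +-cancelˡ-≤ i (suc j) m (≤-trans (≤-reflexive eq) r≤i+m)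

  index⇒edge : ∀ {i} → i < 2 * m → ∃[ c ] ∃[ j ] i + suc (toℕ {m} j) ≡ rank m c
  -- Indices below m belong to copy 1, those from m to 2m - 1 to copy 0.
  index⇒edge {i} i<2m with i <? m
  ... | yes i<m = 1F , copy-index 1F i<m (m≤n+m m i)
  ... | no  i≮m = 0F , copy-index 0F i<2m (+-mono-≤ (≮⇒≥ i≮m) (≤-reflexive (+-identityʳ m)))

  oddGraceful : OddGraceful (G {m})
  oddGraceful = record
    { q         = 2 * m
    ; size      = size
    ; f         = f
    ; injective = λ {u} {v} eq →
        label-injective (fromℕ<-injective _ _ (label-< u) (label-< v) eq)
    ; labels    = labels-odd , odd-labels
    }
    where
    labels-odd : ∀ {k} → EdgeLabels G (toℕ ∘ f) k → FirstOdds (2 * m) k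
    labels-odd (e , refl)
      with (c , j) , e≈ ← edge-surjective e
      with i , i<2m , eq ← edge⇒index c j
      = i , i<2m , trans (edgeLabel-cong {e} {edge (c , j)} e≈) (edgeLabel-edge c j eq)
    odd-labels : ∀ {k} → FirstOdds (2 * m) k → EdgeLabels G (toℕ ∘ f) k
    odd-labels (i , i<2m , refl)
      with c , j , eq ← index⇒edge i<2m
      = edge (c , j) , edgeLabel-edge c j eq

theorem1 : (n : ℕ) → n > 2 → OddGraceful (path n ∧ path 2)
theorem1 (suc m) (s≤s 1<m) = oddGraceful (<⇒≤ 1<m)
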